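{- Let $p,q,r$ be integers with $0\le r<q<p$. Suppose that $p\notin C(q,r)$ and that $p\in C(t,r)$ for every integer $t$ with $q<t<p$. Then $$\{q+1,q+2,\ldots,p-1\}\subseteq C(q,r).$$
   Context: Three-row Chomp. A position is a triple $[p,q,r]$ of integers with $p\ge q\ge r\ge 0$ (row lengths). The moves from $[p,q,r]$ are: reduce the first row to length $a$ with $0\le a<p$, giving $[a,\min(a,q),\min(a,r)]$; reduce the second row to length $a$ with $0\le a<q$, giving $[p,a,\min(a,r)]$; reduce the third row to length $b$ with $0\le b<r$, giving $[p,q,b]$. The player who moves to $[0,0,0]$ loses. A $P$-position is a position from which the previous player wins, and an $N$-position is one from which the next player wins. Equivalently: $[0,0,0]$ is an $N$-position, and a position other than $[0,0,0]$ is a $P$-position if and only if no move from it leads to a $P$-position. The function $f$. For all integers $q\ge r\ge 0$ there is a unique integer $p>r$ such that either (i) $r<p<q$ and $[p,p,r]$ is a $P$-position, or (ii) $p\ge q$ and $[p,q,r]$ is a $P$-position. This integer is denoted $f(q,r)$. For integers $q\ge r\ge 0$, $C(q,r)=\{f(q,b): 0\le b<r\}$. -}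

module Defs where

open import Data.Nat using (ℕ; zero; suc; _+_; _⊓_; _⊔_; _≤_; _<_; _≥_; _>_; z≤n; s≤s)
open import Data.Nat.Properties
open import Data.Nat.Induction using (<-wellFounded)
open import Data.Product using (Σ-syntax; ∃; ∃-syntax; ∃!; _×_; _,_; proj₁; proj₂)
open import Data.Sum using (_⊎_; inj₁; inj₂)
open import Data.Empty using (⊥; ⊥-elim)
open import Induction.WellFounded using (Acc; acc)
open import Relation.Binary.Definitions using (tri<; tri≈; tri>)
open import Relation.Binary.PropositionalEquality
  using (_≡_; _≢_; refl; sym; trans; cong; subst)
open import Relation.Nullary using (¬_)
open import Relation.Unary using (Pred)
open import Level using (0ℓ)

-- The order on the row lengths is kept apart in IsPosition; it is preserved by
-- moves (⟶-position), so play from a genuine position never leaves the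
-- genuine positions. IsF, and hence f and C, consults P only at these when r ≤ q.
record Position : Set where
  constructor [_,_,_]
  field
    row₁ row₂ row₃ : ℕ

IsPosition : Position → Set
IsPosition [ p , q , r ] = p ≥ q × q ≥ r

infix 4 _⟶_

data _⟶_ : Position → Position → Set where
  reduce₁ : ∀ {p q r a} → a < p → [ p , q , r ] ⟶ [ a , a ⊓ q , a ⊓ r ]
  reduce₂ : ∀ {p q r a} → a < q → [ p , q , r ] ⟶ [ p , a , a ⊓ r ]
  reduce₃ : ∀ {p q r b} → b < r → [ p , q , r ] ⟶ [ p , q , b ]

⟶-position : ∀ {s s′} → IsPosition s → s ⟶ s′ → IsPosition s′
⟶-position (p≥q , q≥r) (reduce₁ {a = a} _) = m⊓n≤m a _ , ⊓-monoʳ-≤ a q≥r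
⟶-position (p≥q , q≥r) (reduce₂ {a = a} a<q) = ≤-trans (<⇒≤ a<q) p≥q , m⊓n≤m a _
⟶-position (p≥q , q≥r) (reduce₃ b<r) = p≥q , ≤-trans (<⇒≤ b<r) q≥r

end : Position
end = [ 0 , 0 , 0 ]

-- Outcome classes under the convention that whoever moves to end loses: the
-- player about to move at end has already won, so end is an N-position.
data P : Position → Set
data N : Position → Set

data P where
  previous : ∀ {s} → s ≢ end → (∀ {s′} → s ⟶ s′ → N s′) → P s

data N where
  ended : N end
  next  : ∀ {s s′} → s ⟶ s′ → P s′ → N s

P∧N⇒⊥ : ∀ {s} → P s → N s → ⊥
P∧N⇒⊥ (previous s≢end _) ended = s≢end refl
P∧N⇒⊥ (previous _ all) (next m Ps′) = P∧N⇒⊥ Ps′ (all m)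

P-⇸-P : ∀ {s s′} → P s → s ⟶ s′ → ¬ P s′
P-⇸-P Ps m Ps′ = P∧N⇒⊥ Ps (next m Ps′)

private
  size : Position → ℕ
  size [ p , q , r ] = p + q + r

  ⟶-size : ∀ {s s′} → s ⟶ s′ → size s′ < size s
  ⟶-size (reduce₁ {q = q} {r} {a} a<p) =
    +-mono-<-≤ (+-mono-<-≤ a<p (m⊓n≤n a q)) (m⊓n≤n a r)
  ⟶-size (reduce₂ {p} {r = r} {a} a<q) =
    +-mono-<-≤ (+-monoʳ-< p a<q) (m⊓n≤n a r)
  ⟶-size (reduce₃ {p} {q} b<r) = +-monoʳ-< (p + q) b<r

  search : ∀ {A B : ℕ → Set} n → (∀ a → a < n → A a ⊎ B a) →
           (∃[ a ] (a < n × A a)) ⊎ (∀ a → a < n → B a)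
  search zero _ = inj₂ λ _ ()
  search {A} {B} (suc n) d with d n ≤-refl
  ... | inj₁ An = inj₁ (n , ≤-refl , An)
  ... | inj₂ Bn with search {A} {B} n (λ a a<n → d a (m<n⇒m<1+n a<n))
  ...   | inj₁ (a , a<n , Aa) = inj₁ (a , m<n⇒m<1+n a<n , Aa)
  ...   | inj₂ all = inj₂ go
    where
    go : ∀ a → a < suc n → B a
    go a a<1+n with m≤n⇒m<n∨m≡n (≤-pred a<1+n)
    ... | inj₁ a<n = all a a<n
    ... | inj₂ refl = Bn

  end? : ∀ s → s ≡ end ⊎ s ≢ end
  end? [ zero , zero , zero ] = inj₁ refl
  end? [ suc _ , _ , _ ] = inj₂ λ ()
  end? [ zero , suc _ , _ ] = inj₂ λ ()
  end? [ zero , zero , suc _ ] = inj₂ λ ()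

  classify-acc : ∀ s → Acc _<_ (size s) → P s ⊎ N s
  classify-acc s (acc rs) with end? s
  ... | inj₁ refl = inj₂ ended
  ... | inj₂ s≢end
    with search (Position.row₁ s) (λ a h → classify-acc _ (rs (⟶-size (reduce₁ {q = Position.row₂ s} {Position.row₃ s} h))))
       | search (Position.row₂ s) (λ a h → classify-acc _ (rs (⟶-size (reduce₂ {Position.row₁ s} {r = Position.row₃ s} h))))
       | search (Position.row₃ s) (λ a h → classify-acc _ (rs (⟶-size (reduce₃ {Position.row₁ s} {Position.row₂ s} h))))
  ... | inj₁ (_ , h , Pa) | _ | _ = inj₂ (next (reduce₁ h) Pa)
  ... | inj₂ _ | inj₁ (_ , h , Pa) | _ = inj₂ (next (reduce₂ h) Pa)
  ... | inj₂ _ | inj₂ _ | inj₁ (_ , h , Pa) = inj₂ (next (reduce₃ h) Pa)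
  ... | inj₂ n₁ | inj₂ n₂ | inj₂ n₃ = inj₁ (previous s≢end λ where
          (reduce₁ h) → n₁ _ h
          (reduce₂ h) → n₂ _ h
          (reduce₃ h) → n₃ _ h)

P⊎N : ∀ s → P s ⊎ N s
P⊎N s = classify-acc s (<-wellFounded (size s))

-- Strategy stealing: every move from [ k+1 , k+1 , k ] is also a move from the
-- full rectangle.
rectangle-N : ∀ a → N [ a , a , a ]
rectangle-N zero = ended
rectangle-N (suc k) with P⊎N [ suc k , suc k , k ]
... | inj₁ Ps = next (reduce₃ ≤-refl) Ps
... | inj₂ (next (reduce₁ {a = c} c<) Ps) = next (reduce₁ c<) (subst (λ x → P [ c , c ⊓ suc k , x ]) (trans (m≤n⇒m⊓n≡m (≤-pred c<)) (sym (m≤n⇒m⊓n≡m (<⇒≤ c<)))) Ps)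
... | inj₂ (next (reduce₂ {a = c} c<) Ps) = next (reduce₂ c<) (subst (λ x → P [ suc k , c , x ]) (trans (m≤n⇒m⊓n≡m (≤-pred c<)) (sym (m≤n⇒m⊓n≡m (<⇒≤ c<)))) Ps)
... | inj₂ (next (reduce₃ b<) Ps) = next (reduce₃ (m<n⇒m<1+n b<)) Ps

-- The property that singles out f(q,r).
IsF : ℕ → ℕ → ℕ → Set
IsF q r p = p > r × ((r < p × p < q × P [ p , p , r ]) ⊎ (p ≥ q × P [ p , q , r ]))

private
  IsF⇒P : ∀ {q r p} → IsF q r p → P [ p , p ⊓ q , r ]
  IsF⇒P {r = r} {p} (_ , inj₁ (_ , p<q , Ps)) = subst (λ x → P [ p , x , r ]) (sym (m≤n⇒m⊓n≡m (<⇒≤ p<q))) Ps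
  IsF⇒P {r = r} {p} (_ , inj₂ (p≥q , Ps)) = subst (λ x → P [ p , x , r ]) (sym (m≥n⇒m⊓n≡n p≥q)) Ps

  IsF-≮ : ∀ {q r p p′} → IsF q r p → IsF q r p′ → ¬ p < p′
  IsF-≮ {q} {r} {p} {p′} F F′ p<p′ =
    P-⇸-P (IsF⇒P F′) (reduce₁ p<p′)
      (subst (λ y → P [ p , p ⊓ (p′ ⊓ q) , y ]) (sym (m≥n⇒m⊓n≡n (<⇒≤ (proj₁ F))))
        (subst (λ x → P [ p , x , r ])
          (sym (trans (sym (⊓-assoc p p′ q)) (cong (_⊓ q) (m≤n⇒m⊓n≡m (<⇒≤ p<p′)))))
          (IsF⇒P F)))

  IsF-unique : ∀ {q r p p′} → IsF q r p → IsF q r p′ → p ≡ p′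
  IsF-unique {p = p} {p′} F F′ with <-cmp p p′
  ... | tri< p<p′ _ _ = ⊥-elim (IsF-≮ F F′ p<p′)
  ... | tri≈ _ eq _ = eq
  ... | tri> _ _ p′<p = ⊥-elim (IsF-≮ F′ F p′<p)

  P⇒IsF : ∀ {q r p} → r ≤ q → q ≤ p → P [ p , q , r ] → IsF q r p
  P⇒IsF {q} {r} {p} r≤q q≤p Ps with m≤n⇒m<n∨m≡n (≤-trans r≤q q≤p)
  ... | inj₁ r<p = r<p , inj₂ (q≤p , Ps)
  ... | inj₂ refl with ≤-antisym r≤q q≤p
  ...   | refl = ⊥-elim (P∧N⇒⊥ Ps (rectangle-N p))

  bound : ∀ n (A : ℕ → ℕ → Set) → (∀ a → a < n → ∃[ p ] (∀ x → A a x → x ≡ p)) →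
          ∃[ B ] (∀ a x → a < n → A a x → x ≤ B)
  bound zero A h = 0 , λ _ _ ()
  bound (suc n) A h with bound n A (λ a a<n → h a (m<n⇒m<1+n a<n)) | h n ≤-refl
  ... | B , hB | p , hp = B ⊔ p , go
    where
    go : ∀ a x → a < suc n → A a x → x ≤ B ⊔ p
    go a x a<1+n Ax with m≤n⇒m<n∨m≡n (≤-pred a<1+n)
    ... | inj₁ a<n = ≤-trans (hB a x a<n Ax) (m≤m⊔n B p)
    ... | inj₂ refl = ≤-trans (≤-reflexive (hp x Ax)) (m≤n⊔m B p)

  -- For first rows longer than every f(a,a⊓r) with a < q and every f(q,b) with
  -- b < r, only reductions of the first row can reach a P-position.
  IsF-exists : ∀ q r → r ≤ q → Acc _<_ (q + r) → ∃ (IsF q r)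
  IsF-exists q r r≤q (acc rs)
    with bound q (λ a → IsF a (a ⊓ r))
           (λ a a<q → let (p , F) = IsF-exists a (a ⊓ r) (m⊓n≤m a r) (rs (+-mono-<-≤ a<q (m⊓n≤n a r)))
                      in p , λ _ F′ → IsF-unique F′ F)
       | bound r (IsF q)
           (λ b b<r → let (p , F) = IsF-exists q b (≤-trans (<⇒≤ b<r) r≤q) (rs (+-monoʳ-< q b<r))
                      in p , λ _ F′ → IsF-unique F′ F)
  ... | B₁ , h₁ | B₂ , h₂ = result
    where
    M = suc (q + (B₁ + B₂))

    q≤M : q ≤ M
    q≤M = m≤n⇒m≤1+n (m≤m+n q _)

    B₁<M : B₁ < M
    B₁<M = s≤s (≤-trans (m≤m+n B₁ B₂) (m≤n+m _ q))

    B₂<M : B₂ < M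
    B₂<M = s≤s (≤-trans (m≤n+m B₂ B₁) (m≤n+m _ q))

    first : ∀ a → P [ a , a ⊓ q , a ⊓ r ] → ∃ (IsF q r)
    first a Ps with ≤-total q a
    ... | inj₁ q≤a rewrite m≥n⇒m⊓n≡n q≤a | m≥n⇒m⊓n≡n (≤-trans r≤q q≤a) = a , P⇒IsF r≤q q≤a Ps
    ... | inj₂ a≤q with m≤n⇒m<n∨m≡n a≤q
    ...   | inj₂ refl rewrite ⊓-idem a | m≥n⇒m⊓n≡n r≤q = a , P⇒IsF r≤q a≤q Ps
    ...   | inj₁ a<q with ≤-<-connex a r
    ...     | inj₁ a≤r rewrite m≤n⇒m⊓n≡m a≤q | m≤n⇒m⊓n≡m a≤r = ⊥-elim (P∧N⇒⊥ Ps (rectangle-N a))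
    ...     | inj₂ r<a rewrite m≤n⇒m⊓n≡m a≤q | m≥n⇒m⊓n≡n (<⇒≤ r<a) = a , r<a , inj₁ (r<a , a<q , Ps)

    result : ∃ (IsF q r)
    result with P⊎N [ M , q , r ]
    ... | inj₁ Ps = M , P⇒IsF r≤q q≤M Ps
    ... | inj₂ (next (reduce₁ {a = a} _) Ps) = first a Ps
    ... | inj₂ (next (reduce₂ {a = a} a<q) Ps) =
          ⊥-elim (<⇒≱ B₁<M (h₁ a M a<q (P⇒IsF (m⊓n≤m a r) (≤-trans (<⇒≤ a<q) q≤M) Ps)))
    ... | inj₂ (next (reduce₃ {b = b} b<r) Ps) =
          ⊥-elim (<⇒≱ B₂<M (h₂ b M b<r (P⇒IsF (≤-trans (<⇒≤ b<r) r≤q) q≤M Ps)))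

IsF-∃! : ∀ q r → r ≤ q → ∃! _≡_ (IsF q r)
IsF-∃! q r r≤q =
  let (p , F) = IsF-exists q r r≤q (<-wellFounded (q + r)) in p , F , IsF-unique F

f : ∀ q r → r ≤ q → ℕ
f q r r≤q = proj₁ (IsF-∃! q r r≤q)

-- The component b ≤ q only supplies the domain condition of f; it follows from
-- b < r whenever r ≤ q, the range in which C(q,r) is considered.
C : ℕ → ℕ → Pred ℕ 0ℓ
C q r x = ∃[ b ] (b < r × Σ[ b≤q ∈ b ≤ q ] x ≡ f q b b≤q)

{-# OPTIONS --safe #-}
-- For each t strictly between q and p there is b < r such that [p,t,b] is a
-- P-position. Then [p,q,b], a move away from it, is an N-position, and its
-- winning move must shorten the first row to some y with q < y < p: by
-- hypothesis [p,q,b′] is never a P-position, and every other candidate can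
-- be reached directly from [p,t,b]. Since y determines b and b determines t,
-- the map t ↦ y is an injection of the interval into itself, hence onto, and
-- y = f(q,b).
module Submission where

open import Data.Nat using (ℕ; suc; _+_; _∸_; _⊓_; _≤_; _<_)
open import Data.Nat.Properties
open import Data.Fin using (Fin; toℕ; fromℕ<; punchOut)
open import Data.Fin.Properties as Fin
  using (any?; punchOut-injective; injective⇒≤; toℕ<n; toℕ-injective; toℕ-fromℕ<)
open import Data.Product using (∃-syntax; _×_; _,_; proj₁; proj₂)
open import Data.Sum using (inj₁; inj₂)
open import Function.Definitions using (Injective)
open import Relation.Binary.Definitions using (tri<; tri≈; tri>)
open import Relation.Binary.PropositionalEquality using (_≡_; refl; sym; trans; cong; subst; subst₂)
open import Relation.Nullary using (¬_; yes; no; contradiction)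
open import Relation.Unary using (_∈_; _∉_; _⊆_)
open import Defs

-- If `j` were missed, punching it out of the codomain would turn `g` into an injection of
-- `Fin (suc n)` into `Fin n`.
injective⇒onto : ∀ {n} {g : Fin n → Fin n} → Injective _≡_ _≡_ g → ∀ j → ∃[ i ] g i ≡ j
injective⇒onto {suc n} {g} g-injective j with any? (λ i → g i Fin.≟ j)
... | yes hit = hit
... | no miss = contradiction
        (injective⇒≤ λ {i} {i′} eq →
          g-injective (punchOut-injective (j≢g i) (j≢g i′) eq))
        1+n≰n
  where
  j≢g : ∀ i → ¬ j ≡ g i
  j≢g i eq = miss (i , sym eq)

module _ {q p : ℕ} (q<p : q < p) where

  private
    Between : ℕ → Set
    Between x = q < x × x < p

    -- The integers strictly between `q` and `p` number `p ∸ suc q`; counting starts at `suc q`.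
    point : Fin (p ∸ suc q) → ℕ
    point i = suc q + toℕ i

    point-between : ∀ i → Between (point i)
    point-between i = m≤m+n (suc q) (toℕ i)
                    , subst (point i <_) (m+[n∸m]≡n q<p) (+-monoʳ-< (suc q) (toℕ<n i))

    index : ∀ {x} → Between x → Fin (p ∸ suc q)
    index (q<x , x<p) = fromℕ< (∸-monoˡ-< x<p q<x)

    point-index : ∀ {x} (x∈ : Between x) → point (index x∈) ≡ x
    point-index (q<x , x<p) =
      trans (cong (suc q +_) (toℕ-fromℕ< (∸-monoˡ-< x<p q<x))) (m+[n∸m]≡n q<x)

  -- Choosing one `y` for each `t` gives a self-map of the finite interval. It is injective because
  -- related `y` determines `t`, so every `x` is a chosen value.
  interval-onto : (R : ℕ → ℕ → Set) →
    (∀ {t} → q < t → t < p → ∃[ y ] (q < y × y < p × R t y)) →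
    (∀ {t t′ y} → q < t → q < t′ → R t y → R t′ y → t ≡ t′) →
    ∀ {x} → q < x → x < p → ∃[ t ] (q < t × R t x)
  interval-onto R total R-injective {x} q<x x<p =
    let i , eq = injective⇒onto {g = g} g-injective (index (q<x , x<p)) in
      point i , proj₁ (point-between i) ,
      subst (R (point i)) (trans (cong point eq) (point-index (q<x , x<p))) (R-g i)
    where
    image : ∀ i → ∃[ y ] (q < y × y < p × R (point i) y)
    image i = let q<t , t<p = point-between i in total q<t t<p

    g : Fin (p ∸ suc q) → Fin (p ∸ suc q)
    g i = let _ , q<y , y<p , _ = image i in index (q<y , y<p)

    R-g : ∀ i → R (point i) (point (g i))
    R-g i = let _ , q<y , y<p , Rty = image i in
      subst (R (point i)) (sym (point-index (q<y , y<p))) Rty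

    g-injective : Injective _≡_ _≡_ g
    g-injective {i} {i′} eq = toℕ-injective (+-cancelˡ-≡ (suc q) _ _
      (R-injective (proj₁ (point-between i)) (proj₁ (point-between i′))
        (R-g i) (subst (λ k → R (point i′) (point k)) (sym eq) (R-g i′))))

-- Here `x` satisfies alternative (ii) in the definition of `f`, so uniqueness identifies it with
-- the value of `f` at `q` and `b`.
P⇒∈C : ∀ {x q r b} → b < r → b ≤ q → q < x → P [ x , q , b ] → x ∈ C q r
P⇒∈C {x} {q} {b = b} b<r b≤q q<x Ps =
  b , b<r , b≤q ,
  sym (proj₂ (proj₂ (IsF-∃! q b b≤q)) (≤-<-trans b≤q q<x , inj₂ (<⇒≤ q<x , Ps)))

IsF⇒P : ∀ {x q r} → q < x → IsF q r x → P [ x , q , r ]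
IsF⇒P q<x (_ , inj₁ (_ , x<q , _)) = contradiction x<q (<-asym q<x)
IsF⇒P q<x (_ , inj₂ (_ , Ps)) = Ps

∈C⇒P : ∀ {x q r} → q < x → x ∈ C q r → ∃[ b ] (b < r × P [ x , q , b ])
∈C⇒P {q = q} q<x (b , b<r , b≤q , eq) =
  b , b<r , IsF⇒P q<x (subst (IsF q b) (sym eq) (proj₁ (proj₂ (IsF-∃! q b b≤q))))

P-row₃-unique : ∀ {p q b b′} → P [ p , q , b ] → P [ p , q , b′ ] → b ≡ b′
P-row₃-unique {b = b} {b′} Ps Ps′ with <-cmp b b′
... | tri< b<b′ _ _ = contradiction Ps (P-⇸-P Ps′ (reduce₃ b<b′))
... | tri≈ _ eq _ = eq
... | tri> _ _ b′<b = contradiction Ps′ (P-⇸-P Ps (reduce₃ b′<b))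

reduce₂-above : ∀ {p q a r} → r ≤ a → a < q → [ p , q , r ] ⟶ [ p , a , r ]
reduce₂-above {p} {q} {a} {r} r≤a a<q =
  subst (λ s → [ p , q , r ] ⟶ [ p , a , s ]) (m≥n⇒m⊓n≡n r≤a) (reduce₂ a<q)

-- As `b` is at most both second rows, cutting the longer to the shorter leaves the third row intact
-- and would join two P-positions.
P-row₂-unique : ∀ {p q q′ b} → b ≤ q → b ≤ q′ →
  P [ p , q , b ] → P [ p , q′ , b ] → q ≡ q′
P-row₂-unique {q = q} {q′} b≤q b≤q′ Ps Ps′ with <-cmp q q′
... | tri< q<q′ _ _ = contradiction Ps (P-⇸-P Ps′ (reduce₂-above b≤q q<q′))
... | tri≈ _ eq _ = eq
... | tri> _ _ q′<q = contradiction Ps′ (P-⇸-P Ps (reduce₂-above b≤q′ q′<q))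

shortened-row₂-reply : ∀ {p t q b} → b ≤ q → q < t → q < p →
  P [ p , t , b ] → (∀ {b′} → b′ < b → ¬ P [ p , q , b′ ]) →
  ∃[ y ] (q < y × y < p × P [ y , q , b ])
shortened-row₂-reply {p} {t} {q} {b} b≤q q<t q<p Pt none with P⊎N [ p , q , b ]
... | inj₁ Pq = contradiction Pq (P-⇸-P Pt (reduce₂-above b≤q q<t))
... | inj₂ ended = contradiction q<p n≮0
... | inj₂ (next (reduce₃ b′<b) Ps) = contradiction Ps (none b′<b)
-- Cutting the second row to `a` erases the difference between `q` and `t`.
... | inj₂ (next (reduce₂ a<q) Ps) =
      contradiction Ps (P-⇸-P Pt (reduce₂ (<-trans a<q q<t)))
... | inj₂ (next (reduce₁ {a = a} a<p) Ps) with ≤-<-connex a q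
-- A first row of length `a ≤ q < t` truncates the second row to `a` from either position, so the
-- results coincide.
...   | inj₁ a≤q = contradiction
        (subst (λ x → P [ a , x , a ⊓ b ])
          (trans (m≤n⇒m⊓n≡m a≤q) (sym (m≤n⇒m⊓n≡m (≤-trans a≤q (<⇒≤ q<t))))) Ps)
        (P-⇸-P Pt (reduce₁ a<p))
...   | inj₂ q<a = a , q<a , a<p ,
        subst₂ (λ x y → P [ a , x , y ])
          (m≥n⇒m⊓n≡n (<⇒≤ q<a)) (m≥n⇒m⊓n≡n (≤-trans b≤q (<⇒≤ q<a))) Ps

lemma3p1 : ∀ (p q r : ℕ) → r < q → q < p →
    p ∉ C q r →
    (∀ (t : ℕ) → q < t → t < p → p ∈ C t r) →
    (λ x → q < x × x < p) ⊆ C q r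
lemma3p1 p q r r<q q<p p∉C p∈C (q<x , x<p) =
  let _ , _ , _ , b<r , _ , Px = interval-onto q<p Linked total Linked-injective q<x x<p in
    P⇒∈C b<r (b≤q b<r) q<x Px
  where
  Linked : ℕ → ℕ → Set
  Linked t y = ∃[ b ] (b < r × P [ p , t , b ] × P [ y , q , b ])

  b≤q : ∀ {b} → b < r → b ≤ q
  b≤q b<r = <⇒≤ (<-trans b<r r<q)

  total : ∀ {t} → q < t → t < p → ∃[ y ] (q < y × y < p × Linked t y)
  total {t} q<t t<p =
    let b , b<r , Pt = ∈C⇒P t<p (p∈C t q<t t<p)
        y , q<y , y<p , Py = shortened-row₂-reply (b≤q b<r) q<t q<p Pt λ b′<b Ps →
          let b′<r = <-trans b′<b b<r in p∉C (P⇒∈C b′<r (b≤q b′<r) q<p Ps)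
    in y , q<y , y<p , b , b<r , Pt , Py

  Linked-injective : ∀ {t t′ y} → q < t → q < t′ → Linked t y → Linked t′ y → t ≡ t′
  Linked-injective q<t q<t′ (b , b<r , Pt , Py) (b′ , _ , Pt′ , Py′)
    -- Both witnesses share the rows `y` and `q`, which forces `b` and `b′` to agree; then `Pt` and
    -- `Pt′` can differ only in the second row.
    with refl ← P-row₃-unique Py Py′ =
      P-row₂-unique (≤-trans (b≤q b<r) (<⇒≤ q<t)) (≤-trans (b≤q b<r) (<⇒≤ q<t′)) Pt Pt′
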